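{- Let $G$ be a finite simple graph with girth at least $8$. Then $G$ is b-continuous, i.e. $S_b(G) = [\chi(G), b(G)] \cap \mathbb{Z}$.
   Context: All graphs are finite and simple; the girth of a graph is the minimum length of a cycle in it (infinite if the graph has no cycle). A (proper) $k$-coloring of $G$ is a map $\psi: V(G)\to\mathbb{N}$ with $|\psi(V(G))|=k$ and $\psi(u)\neq\psi(v)$ whenever $uv\in E(G)$; the sets $\psi^{ -1}(i)$ are the color classes. $\chi(G)$ is the chromatic number. Given a coloring $\psi$, a vertex $u$ is a b-vertex if $u$ has a neighbor in every color class other than $\psi^{ -1}(\psi(u))$. A b-coloring is a coloring in which every color class contains at least one b-vertex. The b-spectrum $S_b(G)$ is the set of integers $k$ such that $G$ has a b-coloring with $k$ colors, and the b-chromatic number is $b(G)=\max S_b(G)$. $G$ is b-continuous if $S_b(G)=[\chi(G),b(G)]\cap\mathbb{Z}$. -}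

module Defs where

open import Data.Nat using (ℕ; zero; suc; _≤_)
open import Data.Fin using (Fin; zero; suc; inject₁; fromℕ)
open import Data.Bool using (Bool; true; false)
open import Data.List using (List; length)
open import Data.List.Membership.Propositional using (_∈_)
open import Data.List.Relation.Unary.Unique.Propositional using (Unique)
open import Data.Product using (Σ; ∃; ∃-syntax; _×_)
open import Relation.Binary.PropositionalEquality using (_≡_; _≢_)
open import Function.Definitions using (Injective)
open import Function.Bundles using (_⇔_)

record Graph (n : ℕ) : Set where
  field
    adj    : Fin n → Fin n → Bool
    sym    : ∀ u v → adj u v ≡ adj v u
    irrefl : ∀ v → adj v v ≡ false

module _ {n : ℕ} (G : Graph n) where
  open Graph G

  Adj : Fin n → Fin n → Set
  Adj u v = adj u v ≡ true

  record Cycle (ℓ : ℕ) : Set where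
    field
      m        : ℕ
      len      : ℓ ≡ suc m
      long     : 3 ≤ ℓ
      f        : Fin (suc m) → Fin n
      distinct : Injective _≡_ _≡_ f
      step     : ∀ (i : Fin m) → Adj (f (inject₁ i)) (f (suc i))
      close    : Adj (f (fromℕ m)) (f zero)

  -- girth ≥ g : every cycle has length at least g (vacuous if acyclic,
  -- matching girth = ∞).
  GirthAtLeast : ℕ → Set
  GirthAtLeast g = ∀ ℓ → Cycle ℓ → g ≤ ℓ

  ImageSize : (Fin n → ℕ) → ℕ → Set
  ImageSize ψ k = Σ (List ℕ) λ cs →
      Unique cs × length cs ≡ k
    × (∀ v → ψ v ∈ cs) × (∀ c → c ∈ cs → ∃[ v ] ψ v ≡ c)

  Proper : (Fin n → ℕ) → Set
  Proper ψ = ∀ u v → Adj u v → ψ u ≢ ψ v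

  IsColoring : ℕ → (Fin n → ℕ) → Set
  IsColoring k ψ = ImageSize ψ k × Proper ψ

  IsBVertex : (Fin n → ℕ) → Fin n → Set
  IsBVertex ψ u = ∀ w → ψ w ≢ ψ u → ∃[ x ] (Adj u x × ψ x ≡ ψ w)

  IsBColoring : ℕ → (Fin n → ℕ) → Set
  IsBColoring k ψ = IsColoring k ψ × (∀ w → ∃[ u ] (ψ u ≡ ψ w × IsBVertex ψ u))

  InBSpectrum : ℕ → Set
  InBSpectrum k = ∃[ ψ ] IsBColoring k ψ

  IsChromaticNumber : ℕ → Set
  IsChromaticNumber c = (∃[ ψ ] IsColoring c ψ) × (∀ k → ∃[ ψ ] IsColoring k ψ → c ≤ k)

  IsBChromaticNumber : ℕ → Set
  IsBChromaticNumber b = InBSpectrum b × (∀ k → InBSpectrum k → k ≤ b)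

  BContinuous : Set
  BContinuous = ∀ c b → IsChromaticNumber c → IsBChromaticNumber b →
    ∀ k → InBSpectrum k ⇔ (c ≤ k × k ≤ b)

{-# OPTIONS --safe #-}

-- A χ-colouring in which some class has no b-vertex could be recoloured with fewer colours, so
-- χ ∈ S_b; it remains to pass from k + 1 colours to k whenever k > χ.
--
-- Fix a colour a to be eliminated and keep, in every other class, a vertex that stays a b-vertex
-- once a is gone; call it good if moreover some neighbour of it is not needed for this. Take such
-- a colouring with the class of a as small as possible, and u in that class. For each colour j
-- not found on a good neighbour of u, give the neighbours of u coloured j other colours and then
-- recolour u with j. By minimality this destroys the good vertices of some colour d, which must
-- then all hang on neighbours of u coloured j. Without 4-cycles, j ↦ d is injective on the colours
-- not found on good neighbours of u, hence a permutation of them.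
--
-- * If there are no such colours, then u and its good neighbours form a tree of radius 2. Keep the
--   colours of the tree (minus one colour d), use a χ-colouring elsewhere, and give the vertices
--   that clash with their unique neighbour in the tree a colour unused by the χ-colouring; girth 8
--   makes these vertices independent.
-- * Otherwise eliminate one such colour d instead of a. Good vertices of these colours have no
--   neighbour coloured a, so the ones of colour d can take the colour a, and each of the other
--   colours recovers a b-vertex by giving the colour a to a dispensable neighbour of a good vertex.
module Submission where

open import Defs
open import Data.Bool using (true)
import Data.Bool.Properties as Bool
open import Data.Empty using (⊥; ⊥-elim)
open import Data.Fin using (Fin; zero; suc; toℕ; inject₁; fromℕ; inject≤; punchIn; punchOut)
open import Data.Fin.Properties
  using (_≟_; any?; all?; suc-injective; ¬∀⟶∃¬; toℕ-injective; injective⇒≤; inject≤-injective;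
         punchIn-injective; punchInᵢ≢i; punchOut-injective; punchIn-punchOut)
import Data.Fin.Subset as Subset
open import Data.Fin.Subset.Properties using (p⊂q⇒∣p∣<∣q∣)
open import Data.List using (List; []; _∷_; _++_; _ʳ++_; length; lookup; map; allFin; deduplicate)
open import Data.List.Properties using (length-map; length-tabulate; length-++; length-ʳ++)
open import Data.List.Membership.Propositional using (_∈_; _∉_)
open import Data.List.Membership.Propositional.Properties
  using (∈-∃++; ∈-lookup; ∈-allFin; ∈-map⁺; ∈-map⁻; ∈-deduplicate⁺; ∈-deduplicate⁻)
open import Data.List.Relation.Unary.All as All using (All; []; _∷_)
open import Data.List.Relation.Unary.All.Properties using (++⁻ˡ; ++⁻ʳ; ¬Any⇒All¬; All¬⇒¬Any)
open import Data.List.Relation.Unary.AllPairs using ([]; _∷_)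
open import Data.List.Relation.Unary.Any using (here; there; index)
open import Data.List.Relation.Unary.Any.Properties using (lookup-index)
open import Data.List.Relation.Unary.Unique.Propositional using (Unique)
import Data.List.Relation.Unary.Unique.Propositional.Properties as Unique
open import Data.List.Relation.Unary.Unique.DecPropositional.Properties using (deduplicate-!)
open import Data.Nat using (ℕ; zero; suc; _≤_; _<_; _+_; z≤n; s≤s)
open import Data.Nat.Induction using (<-wellFounded)
open import Data.Nat.Properties
  using (≤-refl; ≤-trans; n≤1+n; m≤m+n; 1+n≰n; m≤n⇒m<n∨m≡n; +-mono-≤; +-suc; +-comm)
open import Data.Product using (Σ; ∃-syntax; _×_; _,_; proj₁; proj₂)
open import Data.Sum using (_⊎_; inj₁; inj₂)
open import Data.Vec using (tabulate)
open import Data.Vec.Properties using (lookup∘tabulate; []=⇒lookup; lookup⇒[]=)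
open import Function using (_∘_; id)
open import Function.Bundles using (mk⇔)
open import Induction.WellFounded using (Acc; acc)
open import Relation.Binary.PropositionalEquality
  using (_≡_; _≢_; refl; sym; trans; cong; subst; ≢-sym)
open import Relation.Nullary using (¬_; Dec; yes; no; does)
open import Relation.Nullary.Decidable using (¬?; _×-dec_; _⊎-dec_; _→-dec_; dec-true)
open import Relation.Unary using (Decidable)

-- Repetition-free lists, finite maps and partial recolourings

unique-lookup-injective : ∀ {A : Set} {xs : List A} → Unique xs →
  ∀ {i j} → lookup xs i ≡ lookup xs j → i ≡ j
unique-lookup-injective (x∉ ∷ u) {zero}  {zero}  eq = refl
unique-lookup-injective (x∉ ∷ u) {zero}  {suc j} eq = ⊥-elim (All.lookup x∉ (∈-lookup j) eq)
unique-lookup-injective (x∉ ∷ u) {suc i} {zero}  eq = ⊥-elim (All.lookup x∉ (∈-lookup i) (sym eq))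
unique-lookup-injective (x∉ ∷ u) {suc i} {suc j} eq = cong suc (unique-lookup-injective u eq)

-- Turns the vertices of a walk up to its return to `v` into those of a cycle listed from `v`.
unique-rotate : ∀ {A : Set} (xs : List A) {v ys} → Unique (xs ++ v ∷ ys) → Unique (v ∷ xs)
unique-rotate []       u        = [] ∷ []
unique-rotate (x ∷ xs) (x∉ ∷ u) with unique-rotate xs u
... | v∉ ∷ u′ = ((λ v≡x → All.head (++⁻ʳ xs x∉) (sym v≡x)) ∷ v∉) ∷ (++⁻ˡ xs x∉ ∷ u′)

unique-ʳ++⁻ʳ : ∀ {A : Set} (xs : List A) {ys} → Unique (xs ʳ++ ys) → Unique ys
unique-ʳ++⁻ʳ []       u = u
unique-ʳ++⁻ʳ (x ∷ xs) u with unique-ʳ++⁻ʳ xs u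
... | _ ∷ u′ = u′

unique-ʳ++-disjoint : ∀ {A : Set} (xs : List A) {ys v} → Unique (xs ʳ++ ys) → v ∈ xs → v ∉ ys
unique-ʳ++-disjoint (x ∷ xs) u (here refl)  v∈ys with unique-ʳ++⁻ʳ xs u
... | x∉ ∷ _ = All.lookup x∉ v∈ys refl
unique-ʳ++-disjoint (x ∷ xs) u (there v∈xs) v∈ys = unique-ʳ++-disjoint xs u v∈xs (there v∈ys)

unique-length : ∀ {m} {xs : List (Fin m)} → Unique xs → length xs ≤ m
unique-length {xs = xs} u = injective⇒≤ {f = lookup xs} (unique-lookup-injective u)

∀-⊎ : ∀ {m} {R : Set} {P : Fin m → Set} → (∀ i → R ⊎ P i) → R ⊎ (∀ i → P i)
∀-⊎ {zero}  h = inj₂ λ ()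
∀-⊎ {suc m} h with h zero | ∀-⊎ (h ∘ suc)
... | inj₁ r | _       = inj₁ r
... | inj₂ _ | inj₁ r  = inj₁ r
... | inj₂ p | inj₂ ps = inj₂ λ { zero → p ; (suc i) → ps i }

-- A missed value could be punched out, which would inject `Fin (suc m)` into `Fin m`.
injective⇒surjective : ∀ {m} (f : Fin m → Fin m) → (∀ {i j} → f i ≡ f j → i ≡ j) →
  ∀ y → ∃[ x ] f x ≡ y
injective⇒surjective {suc m} f inj y with any? (λ x → f x ≟ y)
... | yes p = p
... | no ∄x = ⊥-elim (1+n≰n (injective⇒≤
        {f = λ x → punchOut {i = y} {j = f x} (λ y≡fx → ∄x (x , sym y≡fx))}
        (λ eq → inj (punchOut-injective {i = y} _ _ eq))))

module _ {n : ℕ} {C : Set} {Q : Fin n → Set} (Q? : Decidable Q) where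

  -- The new value may depend on the proof of `Q v`, since a new colour is often extracted from a
  -- witness.
  patch : (∀ v → Q v → C) → (Fin n → C) → Fin n → C
  patch m φ v with Q? v
  ... | yes q = m v q
  ... | no  _ = φ v

  patch-elim : ∀ m φ v (P : C → Set) → (∀ q → P (m v q)) → (¬ Q v → P (φ v)) → P (patch m φ v)
  patch-elim m φ v P y n with Q? v
  ... | yes q = y q
  ... | no ¬q = n ¬q

  patch-no : ∀ m φ v → ¬ Q v → patch m φ v ≡ φ v
  patch-no m φ v ¬q = patch-elim m φ v (_≡ φ v) (⊥-elim ∘ ¬q) (λ _ → refl)

module _ {n : ℕ} (G : Graph n) where

  private
    V = Fin n

  infix 4 _~_ _~?_

  _~_ : V → V → Set
  _~_ = Adj G

  _~?_ : ∀ u v → Dec (u ~ v)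
  u ~? v = Graph.adj G u v Bool.≟ true

  ~-sym : ∀ {u v} → u ~ v → v ~ u
  ~-sym {u} {v} = trans (Graph.sym G v u)

  ~-irrefl : ∀ {v} → ¬ v ~ v
  ~-irrefl {v} v~v with trans (sym v~v) (Graph.irrefl G v)
  ... | ()

  -- Walks and girth

  -- Only a local condition is asked of a walk; the girth then makes every short one a path.
  data NonBacktracking : List V → Set where
    single : ∀ {v} → NonBacktracking (v ∷ [])
    edge   : ∀ {v w} → v ~ w → NonBacktracking (v ∷ w ∷ [])
    step   : ∀ {v w x l} → v ~ w → v ≢ x →
             NonBacktracking (w ∷ x ∷ l) → NonBacktracking (v ∷ w ∷ x ∷ l)

  nb-head : ∀ {v w l} → NonBacktracking (v ∷ w ∷ l) → v ~ w
  nb-head (edge e)     = e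
  nb-head (step e _ _) = e

  nb-tail : ∀ {v w l} → NonBacktracking (v ∷ w ∷ l) → NonBacktracking (w ∷ l)
  nb-tail (edge _)     = single
  nb-tail (step _ _ p) = p

  nb-step : ∀ {v} ys {zs} → NonBacktracking (v ∷ ys ++ zs) →
    ∀ i → lookup (v ∷ ys) (inject₁ i) ~ lookup ys i
  nb-step (y ∷ ys) p zero    = nb-head p
  nb-step (y ∷ ys) p (suc i) = nb-step ys (nb-tail p) i

  nb-last : ∀ {v} ys {z zs} → NonBacktracking (v ∷ ys ++ z ∷ zs) →
    lookup (v ∷ ys) (fromℕ (length ys)) ~ z
  nb-last []       p = nb-head p
  nb-last (y ∷ ys) p = nb-last ys (nb-tail p)

  -- The first walk is read backwards into `w` and continued by the second; `p ≢ q` is the condition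
  -- for not backtracking at `w`.
  nb-ʳ++ : ∀ {w p} xs {q ys} → NonBacktracking (w ∷ p ∷ xs) → NonBacktracking (w ∷ q ∷ ys) →
    p ≢ q → NonBacktracking (xs ʳ++ p ∷ w ∷ q ∷ ys)
  nb-ʳ++ []       (edge w~p)         r p≢q = step (~-sym w~p) p≢q r
  nb-ʳ++ (x ∷ xs) (step w~p w≢x wpx) r p≢q = nb-ʳ++ xs wpx (step (~-sym w~p) p≢q r) (≢-sym w≢x)

  module _ (girth : GirthAtLeast G 8) where

    -- The stretch up to the return would be a cycle on at most 7 vertices; returns after one or two
    -- edges are a loop and a backtrack.
    nb-no-return : ∀ {v l} → NonBacktracking (v ∷ l) → Unique l → length l ≤ 7 → v ∉ l
    nb-no-return {v} p u l≤7 v∈l with ∈-∃++ v∈l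
    nb-no-return {v} p u l≤7 v∈l | []     , zs , refl = ~-irrefl (nb-head p)
    nb-no-return {v} (step _ v≢v _) u l≤7 v∈l | _ ∷ [] , zs , refl = v≢v refl
    nb-no-return {v} p u l≤7 v∈l | ys@(_ ∷ _ ∷ _) , zs , refl = 1+n≰n (≤-trans 8≤len len≤7)
      where
      cycle : Cycle G (suc (length ys))
      cycle = record
        { m = length ys ; len = refl ; long = s≤s (s≤s (s≤s z≤n)) ; f = lookup (v ∷ ys)
        ; distinct = unique-lookup-injective (unique-rotate ys u)
        ; step = nb-step ys p ; close = nb-last ys p }
      8≤len = girth _ cycle
      len≤7 : suc (length ys) ≤ 7
      len≤7 = ≤-trans (≤-trans (s≤s (m≤m+n _ _)) (subst (suc (length ys + length zs) ≤_)
                (sym (trans (length-++ ys) (+-suc (length ys) (length zs)))) ≤-refl)) l≤7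

    nb-unique : ∀ {l} → NonBacktracking l → length l ≤ 8 → Unique l
    nb-unique single _ = [] ∷ []
    nb-unique p@(edge e) (s≤s le) =
      ¬Any⇒All¬ _ (nb-no-return p ([] ∷ []) le) ∷ ([] ∷ [])
    nb-unique p@(step _ _ q) (s≤s le) =
      let u = nb-unique q (≤-trans le (n≤1+n _)) in ¬Any⇒All¬ _ (nb-no-return p u le) ∷ u

    -- Most closed walks below are refuted by this; `length l` counts their edges.
    no-short-return : ∀ {v l} → NonBacktracking (v ∷ l) → length l ≤ 7 → v ∉ l
    no-short-return p le with nb-unique p (s≤s le)
    ... | v∉l ∷ _ = All¬⇒¬Any v∉l

    -- Different first steps would join the two walks to one on at most 8 vertices, hence a path,
    -- yet `u` occurs on both sides of `w`.
    step-towards-unique : ∀ {w p q u xs ys} →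
      NonBacktracking (w ∷ p ∷ xs) → NonBacktracking (w ∷ q ∷ ys) →
      u ∈ p ∷ xs → u ∈ q ∷ ys → length xs + length ys ≤ 5 → p ≡ q
    step-towards-unique {w} {p} {q} {u} {xs} {ys} P Q u∈P u∈Q le with p ≟ q
    ... | yes p≡q = p≡q
    ... | no  p≢q = ⊥-elim (unique-ʳ++-disjoint (p ∷ xs) (nb-unique (nb-ʳ++ xs P Q p≢q) len) u∈P (there u∈Q))
      where
      len : length (xs ʳ++ p ∷ w ∷ q ∷ ys) ≤ 8
      len rewrite length-ʳ++ xs {p ∷ w ∷ q ∷ ys}
                | +-comm (length xs) (3 + length ys) | +-comm (length ys) (length xs) = s≤s (s≤s (s≤s le))

    no-triangle : ∀ {x y z} → x ~ y → y ~ z → z ~ x → ⊥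
    no-triangle {x} {y} {z} xy yz zx =
      no-short-return (step xy (λ { refl → ~-irrefl zx }) (step yz (λ { refl → ~-irrefl xy }) (edge zx)))
        (s≤s (s≤s (s≤s z≤n))) (there (there (here refl)))

    common-neighbour-unique : ∀ {u t x y} → u ≢ t → u ~ x → t ~ x → u ~ y → t ~ y → x ≡ y
    common-neighbour-unique u≢t ux tx uy ty =
      step-towards-unique (step ux u≢t (edge (~-sym tx))) (step uy u≢t (edge (~-sym ty)))
        (there (here refl)) (there (here refl)) (s≤s (s≤s z≤n))

  -- Colourings with finitely many colours

  IsProper : ∀ {C : Set} → (V → C) → Set
  IsProper φ = ∀ {u v} → u ~ v → φ u ≢ φ v

  Sees : ∀ {C : Set} → (V → C) → V → C → Set
  Sees φ t c = ∃[ x ] (t ~ x × φ x ≡ c)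

  abstract
    Sees? : ∀ {m} (φ : V → Fin m) t c → Dec (Sees φ t c)
    Sees? φ t c = any? λ x → (t ~? x) ×-dec (φ x ≟ c)

  patch-proper : ∀ {C : Set} {Q : V → Set} (Q? : Decidable Q) (m : ∀ v → Q v → C) (φ : V → C) →
    (∀ {v x} (q : Q v) (r : Q x) → v ~ x → m v q ≢ m x r) →
    (∀ {v x} (q : Q v) → ¬ Q x → v ~ x → m v q ≢ φ x) →
    (∀ {v x} → ¬ Q v → ¬ Q x → v ~ x → φ v ≢ φ x) →
    IsProper (patch Q? m φ)
  patch-proper Q? m φ both one none {v} {x} v~x =
    patch-elim Q? m φ v (_≢ patch Q? m φ x)
      (λ q → patch-elim Q? m φ x (m v q ≢_)
        (λ r → both q r v~x) (λ ¬r → one q ¬r v~x))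
      (λ ¬q → patch-elim Q? m φ x (φ v ≢_)
        (λ r eq → one r ¬q (~-sym v~x) (sym eq)) (λ ¬r → none ¬q ¬r v~x))

  ImageSize⇒Fin : ∀ {k ψ} → ImageSize G ψ k → Σ (V → Fin k) λ φ →
    (∀ {v w} → φ v ≡ φ w → ψ v ≡ ψ w) × (∀ {v w} → ψ v ≡ ψ w → φ v ≡ φ w) ×
    (∀ c → ∃[ v ] φ v ≡ c)
  ImageSize⇒Fin {ψ = ψ} (cs , u , refl , cover , hit) = φ , φ⇒ψ , ψ⇒φ , onto
    where
    φ : V → Fin (length cs)
    φ v = index (cover v)
    at : ∀ v → ψ v ≡ lookup cs (φ v)
    at v = lookup-index (cover v)
    φ⇒ψ : ∀ {v w} → φ v ≡ φ w → ψ v ≡ ψ w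
    φ⇒ψ {v} {w} eq = trans (at v) (trans (cong (lookup cs) eq) (sym (at w)))
    ψ⇒φ : ∀ {v w} → ψ v ≡ ψ w → φ v ≡ φ w
    ψ⇒φ {v} {w} eq = unique-lookup-injective u (trans (sym (at v)) (trans eq (at w)))
    onto : ∀ c → ∃[ v ] φ v ≡ c
    onto c with hit (lookup cs c) (∈-lookup c)
    ... | v , eq = v , unique-lookup-injective u (trans (sym (at v)) eq)

  IsColoring⇒Fin : ∀ {k ψ} → IsColoring G k ψ →
    Σ (V → Fin k) λ φ → IsProper φ × (∀ c → ∃[ v ] φ v ≡ c)
  IsColoring⇒Fin (size , proper) with ImageSize⇒Fin size
  ... | φ , φ⇒ψ , _ , onto = φ , (λ {u} {v} u~v eq → proper u v u~v (φ⇒ψ eq)) , onto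

  InBSpectrum⇒Fin : ∀ {k} → InBSpectrum G k → Σ (V → Fin k) λ φ →
    IsProper φ × (∀ c → ∃[ t ] (φ t ≡ c × (∀ c′ → c′ ≢ c → Sees φ t c′)))
  InBSpectrum⇒Fin {k} (ψ , (size , proper) , b) with ImageSize⇒Fin size
  ... | φ , φ⇒ψ , ψ⇒φ , onto = φ , (λ {u} {v} u~v eq → proper u v u~v (φ⇒ψ eq)) , bvertex
    where
    bvertex : ∀ c → ∃[ t ] (φ t ≡ c × (∀ c′ → c′ ≢ c → Sees φ t c′))
    bvertex c with onto c
    ... | w , refl with b w
    ... | t , ψt≡ψw , bt = t , ψ⇒φ ψt≡ψw , λ c′ c′≢c → sees c′ c′≢c (onto c′)
      where
      sees : ∀ c′ → c′ ≢ φ w → (∃[ w′ ] φ w′ ≡ c′) → Sees φ t c′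
      sees _ c′≢c (w′ , refl) with bt w′ (λ eq → c′≢c (ψ⇒φ (trans eq ψt≡ψw)))
      ... | x , t~x , eq = x , t~x , ψ⇒φ eq

  Fin⇒IsColoring : ∀ {m} (φ : V → Fin m) → IsProper φ → ∃[ k ] (k ≤ m × ∃[ ψ ] IsColoring G k ψ)
  Fin⇒IsColoring {m} φ proper =
    length (map toℕ cs) , subst (_≤ m) (sym (length-map toℕ cs)) (unique-length u) , toℕ ∘ φ ,
    (map toℕ cs , Unique.map⁺ toℕ-injective u , refl , cover , hit) ,
    (λ _ _ u~v eq → proper u~v (toℕ-injective eq))
    where
    cs : List (Fin m)
    cs = deduplicate _≟_ (map φ (allFin n))
    u : Unique cs
    u = deduplicate-! _≟_ (map φ (allFin n))
    cover : ∀ v → toℕ (φ v) ∈ map toℕ cs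
    cover v = ∈-map⁺ toℕ (∈-deduplicate⁺ _≟_ (∈-map⁺ φ (∈-allFin v)))
    hit : ∀ c → c ∈ map toℕ cs → ∃[ v ] toℕ (φ v) ≡ c
    hit c c∈ with ∈-map⁻ toℕ c∈
    ... | i , i∈ , c≡i with ∈-map⁻ φ (∈-deduplicate⁻ _≟_ (map φ (allFin n)) i∈)
    ... | v , _ , i≡φv = v , sym (trans c≡i (cong toℕ i≡φv))

  Fin⇒InBSpectrum : ∀ {m} (φ : V → Fin m) → IsProper φ →
    (∀ c → ∃[ t ] (φ t ≡ c × (∀ c′ → c′ ≢ c → Sees φ t c′))) → InBSpectrum G m
  Fin⇒InBSpectrum {m} φ proper b =
    toℕ ∘ φ ,
    ((map toℕ (allFin m) , Unique.map⁺ toℕ-injective (Unique.allFin⁺ m) ,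
      trans (length-map toℕ (allFin m)) (length-tabulate id) ,
      (λ v → ∈-map⁺ toℕ (∈-allFin (φ v))) , hit) ,
     (λ _ _ u~v eq → proper u~v (toℕ-injective eq))) ,
    bvertex
    where
    hit : ∀ c → c ∈ map toℕ (allFin m) → ∃[ v ] toℕ (φ v) ≡ c
    hit c c∈ with ∈-map⁻ toℕ c∈
    ... | i , _ , c≡i with b i
    ... | t , φt≡i , _ = t , trans (cong toℕ φt≡i) (sym c≡i)
    bvertex : ∀ w → ∃[ t ] (toℕ (φ t) ≡ toℕ (φ w) × IsBVertex G (toℕ ∘ φ) t)
    bvertex w with b (φ w)
    ... | t , φt≡φw , sees = t , cong toℕ φt≡φw , λ w′ ne →
      let x , t~x , eq = sees (φ w′) (λ eq → ne (cong toℕ (trans eq (sym φt≡φw))))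
      in  x , t~x , cong toℕ eq

  module _ {m} (φ : V → Fin (suc m)) (d : Fin (suc m)) (avoids : ∀ v → φ v ≢ d) where

    private
      out : V → Fin m
      out v = punchOut (≢-sym (avoids v))

      out-≡ : ∀ {v c} → φ v ≡ punchIn d c → out v ≡ c
      out-≡ {v} {c} eq = punchIn-injective d _ _ (trans (punchIn-punchOut _) eq)

      out-injective : ∀ {v w} → out v ≡ out w → φ v ≡ φ w
      out-injective = punchOut-injective {i = d} _ _

    avoiding⇒IsColoring : IsProper φ → ∃[ k ] (k ≤ m × ∃[ ψ ] IsColoring G k ψ)
    avoiding⇒IsColoring proper = Fin⇒IsColoring out (λ u~v eq → proper u~v (out-injective eq))

    avoiding⇒InBSpectrum : IsProper φ →
      (∀ c → c ≢ d → ∃[ t ] (φ t ≡ c × (∀ c′ → c′ ≢ d → c′ ≢ c → Sees φ t c′))) →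
      InBSpectrum G m
    avoiding⇒InBSpectrum proper b =
      Fin⇒InBSpectrum out (λ u~v eq → proper u~v (out-injective eq)) bvertex
      where
      bvertex : ∀ c → ∃[ t ] (out t ≡ c × (∀ c′ → c′ ≢ c → Sees out t c′))
      bvertex c with b (punchIn d c) (punchInᵢ≢i d c)
      ... | t , φt≡c , sees = t , out-≡ φt≡c , λ c′ c′≢c →
        let x , t~x , eq = sees (punchIn d c′) (punchInᵢ≢i d c′) (c′≢c ∘ punchIn-injective d c′ c)
        in  x , t~x , out-≡ eq

  abstract
    -- The class of `d` is independent, so all its vertices can move at once, each to a colour that
    -- it misses.
    eliminate-colour : ∀ {m} (φ : V → Fin m) d → IsProper φ →
      (∀ v → φ v ≡ d → ∃[ c ] (c ≢ d × ¬ Sees φ v c)) →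
      Σ (V → Fin m) λ φ′ → IsProper φ′ × (∀ v → φ′ v ≢ d) × (∀ v → φ v ≢ d → φ′ v ≡ φ v)
    eliminate-colour {m} φ d proper missing =
      patch InClass? new φ ,
      patch-proper InClass? new φ
        (λ q r v~x _ → proper v~x (trans q (sym r)))
        (λ {v} {x} q _ v~x eq → proj₂ (proj₂ (missing v q)) (x , v~x , sym eq))
        (λ _ _ → proper) ,
      (λ v → patch-elim InClass? new φ v (_≢ d) (λ q → proj₁ (proj₂ (missing v q))) id) ,
      patch-no InClass? new φ
      where
      InClass? : Decidable (λ v → φ v ≡ d)
      InClass? v = φ v ≟ d
      new : ∀ v → φ v ≡ d → Fin m
      new v q = proj₁ (missing v q)

  sees-all-or-misses : ∀ {m} (φ : V → Fin m) d t →
    (∀ c → c ≢ d → Sees φ t c) ⊎ ∃[ c ] (c ≢ d × ¬ Sees φ t c)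
  sees-all-or-misses φ d t with any? (λ c → ¬? (c ≟ d) ×-dec ¬? (Sees? φ t c))
  ... | yes missed = inj₂ missed
  ... | no ∄ = inj₁ all
    where
    all : ∀ c → c ≢ d → Sees φ t c
    all c c≢d with Sees? φ t c
    ... | yes s = s
    ... | no ¬s = ⊥-elim (∄ (c , c≢d , ¬s))

  missing-colour : ∀ {m} (φ : V → Fin m) d t → ¬ (∀ c → c ≢ d → Sees φ t c) →
    ∃[ c ] (c ≢ d × ¬ Sees φ t c)
  missing-colour φ d t ¬all with sees-all-or-misses φ d t
  ... | inj₁ all    = ⊥-elim (¬all all)
  ... | inj₂ missed = missed

  chromatic∈spectrum : ∀ {c} → IsChromaticNumber G c → InBSpectrum G c
  chromatic∈spectrum {c} ((ψ , col) , minimal) with IsColoring⇒Fin col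
  ... | φ , proper , onto with all? (λ d → any? λ t → (φ t ≟ d) ×-dec
          all? λ c′ → ¬? (c′ ≟ d) →-dec Sees? φ t c′)
  ... | yes b = Fin⇒InBSpectrum φ proper b
  ... | no ¬b with ¬∀⟶∃¬ c _ (λ d → any? λ t → (φ t ≟ d) ×-dec
          all? λ c′ → ¬? (c′ ≟ d) →-dec Sees? φ t c′) ¬b
  chromatic∈spectrum {suc m} ((ψ , col) , minimal) | φ , proper , onto | no ¬b | d , ¬bd
    with eliminate-colour φ d proper
           (λ v φv≡d → missing-colour φ d v (λ all → ¬bd (v , φv≡d , all)))
  ... | φ′ , proper′ , avoids , _ with avoiding⇒IsColoring φ′ d avoids proper′
  ... | k , k≤m , ψ′ = ⊥-elim (1+n≰n (≤-trans (minimal k ψ′) k≤m))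

  -- Good vertices and the colour `a` to be eliminated

  module _ {k : ℕ} (a : Fin (suc k)) where

    private
      C = Fin (suc k)

    -- t sees all colours other than a and its own even when its neighbour y is disregarded.
    Spare : (V → C) → V → V → Set
    Spare ψ t y = ∀ c → c ≢ a → c ≢ ψ t → ∃[ x ] (t ~ x × x ≢ y × ψ x ≡ c)

    abstract
      Spare? : ∀ ψ t y → Dec (Spare ψ t y)
      Spare? ψ t y = all? λ c → ¬? (c ≟ a) →-dec (¬? (c ≟ ψ t) →-dec
                     any? λ x → (t ~? x) ×-dec (¬? (x ≟ y) ×-dec (ψ x ≟ c)))

    -- The dispensable neighbour `y` may itself be coloured `a`, as it is at the start of the
    -- descent.
    Good : (V → C) → V → Set
    Good ψ t = ∃[ y ] (t ~ y × Spare ψ t y)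

    abstract
      Good? : ∀ ψ t → Dec (Good ψ t)
      Good? ψ t = any? λ y → (t ~? y) ×-dec Spare? ψ t y

    GoodNeighbour : (V → C) → V → C → Set
    GoodNeighbour ψ u c = ∃[ t ] (u ~ t × ψ t ≡ c × Good ψ t)

    abstract
      GoodNeighbour? : ∀ ψ u c → Dec (GoodNeighbour ψ u c)
      GoodNeighbour? ψ u c = any? λ t → (u ~? t) ×-dec ((ψ t ≟ c) ×-dec Good? ψ t)

    -- The invariant kept while the class of `a` shrinks.
    Represented : (V → C) → Set
    Represented ψ = ∀ c → c ≢ a → ∃[ t ] (ψ t ≡ c × Good ψ t)

    -- Recolouring all neighbours of u of colour j spoils every good vertex of colour d.
    Hangs : (V → C) → V → C → C → Set
    Hangs ψ u j d = ∀ t y → ψ t ≡ d → t ~ y → Spare ψ t y →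
      ∃[ x ] (u ~ x × t ~ x × ψ x ≡ j × x ≢ y)

    classSize : (V → C) → ℕ
    classSize ψ = Subset.∣ tabulate (λ v → does (ψ v ≟ a)) ∣

    classSize-< : ∀ {ψ ψ′} → (∀ v → ψ′ v ≡ a → ψ v ≡ a) →
      ∀ u → ψ u ≡ a → ψ′ u ≢ a → classSize ψ′ < classSize ψ
    classSize-< {ψ} {ψ′} sub u ψu ψ′u =
      p⊂q⇒∣p∣<∣q∣ ((λ {v} v∈ → into ψ v (sub v (from ψ′ v v∈))) , u , into ψ u ψu , ψ′u ∘ from ψ′ u)
      where
      class : (V → C) → Subset.Subset n
      class χ = tabulate (λ v → does (χ v ≟ a))
      into : ∀ χ v → χ v ≡ a → v Subset.∈ class χ
      into χ v eq = lookup⇒[]= v (class χ) (trans (lookup∘tabulate _ v) (dec-true (χ v ≟ a) eq))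
      from : ∀ χ v → v Subset.∈ class χ → χ v ≡ a
      from χ v v∈ with χ v ≟ a | trans (sym (lookup∘tabulate (λ v → does (χ v ≟ a)) v)) ([]=⇒lookup v∈)
      ... | yes eq | _ = eq
      ... | no _   | ()

    Improvable : (V → C) → Set
    Improvable ψ = Σ (V → C) λ ψ′ → classSize ψ′ < classSize ψ × IsProper ψ′ × Represented ψ′

    -- The vertex `y` and the neighbours coloured `a` may change at will, since `Spare` relies on
    -- none of them.
    spare-transfer : ∀ {ψ ψ′ t y} → ψ′ t ≡ ψ t →
      (∀ {x} → t ~ x → x ≢ y → ψ x ≢ a → ψ′ x ≡ ψ x) → Spare ψ t y → Spare ψ′ t y
    spare-transfer {ψ} {ψ′} {t} {y} same keep sp c c≢a c≢ψ′t
      with sp c c≢a (λ eq → c≢ψ′t (trans eq (sym same)))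
    ... | x , t~x , x≢y , refl = x , t~x , x≢y , keep t~x x≢y c≢a

    -- Shrinking the class of a

    recolour-into-missing : ∀ {ψ u c} → IsProper ψ → Represented ψ → ψ u ≡ a →
      c ≢ a → ¬ Sees ψ u c → Improvable ψ
    recolour-into-missing {ψ} {u} {c} proper rep ψu≡a c≢a ¬sees =
      ψ′ ,
      classSize-< {ψ} {ψ′}
        (λ v → patch-elim (_≟ u) new ψ v (λ e → e ≡ a → ψ v ≡ a) (λ { refl _ → ψu≡a }) (λ _ → id))
        u ψu≡a (patch-elim (_≟ u) new ψ u (_≢ a) (λ _ → c≢a) (λ u≢u → ⊥-elim (u≢u refl))) ,
      patch-proper (_≟ u) new ψ
        (λ { refl refl u~u → ⊥-elim (~-irrefl u~u) })
        (λ { refl _ u~x eq → ¬sees (_ , u~x , sym eq) })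
        (λ _ _ → proper) ,
      rep′
      where
      new : ∀ v → v ≡ u → C
      new _ _ = c
      ψ′ : V → C
      ψ′ = patch (_≟ u) new ψ
      keep : ∀ {x} → ψ x ≢ a → ψ′ x ≡ ψ x
      keep ψx≢a = patch-no (_≟ u) new ψ _ (λ { refl → ψx≢a ψu≡a })
      rep′ : Represented ψ′
      rep′ e e≢a with rep e e≢a
      ... | t , refl , y , t~y , sp =
        t , keep e≢a , y , t~y , spare-transfer (keep e≢a) (λ _ _ → keep) sp

    -- A neighbour of `u` coloured `j` misses some colour besides `a` and `j`: otherwise it would be
    -- good, with `u` as dispensable neighbour. These vertices are independent, so all move at once
    -- and `u` takes `j`. The class of `a` shrinks, so only the loss of a represented colour can
    -- prevent an improvement.
    empty-neighbour-class : ∀ {ψ u j} → IsProper ψ → ψ u ≡ a →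
      (∀ c → c ≢ a → Sees ψ u c) → j ≢ a → ¬ GoodNeighbour ψ u j →
      Improvable ψ ⊎ ∃[ d ] (d ≢ a × d ≢ j × Hangs ψ u j d)
    empty-neighbour-class {ψ} {u} {j} proper ψu≡a full j≢a ¬good = result
      where
      X : V → Set
      X v = u ~ v × ψ v ≡ j
      X? : Decidable X
      X? v = (u ~? v) ×-dec (ψ v ≟ j)

      missing : ∀ v → X v → ∃[ c ] (c ≢ a × c ≢ j × ¬ Sees ψ v c)
      missing v (u~v , ψv≡j)
        with any? (λ c → ¬? (c ≟ a) ×-dec (¬? (c ≟ j) ×-dec ¬? (Sees? ψ v c)))
      ... | yes p = p
      ... | no ∄ = ⊥-elim (¬good (v , u~v , ψv≡j , u , ~-sym u~v , spare))
        where
        spare : Spare ψ v u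
        spare c c≢a c≢ψv with Sees? ψ v c
        ... | yes (x , v~x , refl) = x , v~x , (λ { refl → c≢a ψu≡a }) , refl
        ... | no ¬s = ⊥-elim (∄ (c , c≢a , (λ { refl → c≢ψv (sym ψv≡j) }) , ¬s))

      new : ∀ v → X v → C
      new v q = proj₁ (missing v q)
      φ : V → C
      φ = patch X? new ψ
      ψ′ : V → C
      ψ′ = patch (_≟ u) (λ _ _ → j) φ

      φ-proper : IsProper φ
      φ-proper = patch-proper X? new ψ
        (λ q r v~x _ → proper v~x (trans (proj₂ q) (sym (proj₂ r))))
        (λ {v} q _ v~x eq → proj₂ (proj₂ (proj₂ (missing v q))) (_ , v~x , sym eq))
        (λ _ _ → proper)

      φ-≢j : ∀ {x} → u ~ x → φ x ≢ j
      φ-≢j {x} u~x = patch-elim X? new ψ x (_≢ j)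
        (λ q → proj₁ (proj₂ (proj₂ (missing x q)))) (λ ¬q eq → ¬q (u~x , eq))

      ψ′-proper : IsProper ψ′
      ψ′-proper = patch-proper (_≟ u) (λ _ _ → j) φ
        (λ { refl refl u~u → ⊥-elim (~-irrefl u~u) })
        (λ { refl _ u~x eq → φ-≢j u~x (sym eq) })
        (λ _ _ → φ-proper)

      ψ′u≡j : ψ′ u ≡ j
      ψ′u≡j = patch-elim (_≟ u) (λ _ _ → j) φ u (_≡ j) (λ _ → refl) (λ u≢u → ⊥-elim (u≢u refl))

      keep : ∀ {x} → x ≢ u → ¬ X x → ψ′ x ≡ ψ x
      keep x≢u ¬Xx = trans (patch-no (_≟ u) (λ _ _ → j) φ _ x≢u) (patch-no X? new ψ _ ¬Xx)

      keep-≢ : ∀ {x} → ψ x ≢ a → ψ x ≢ j → ψ′ x ≡ ψ x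
      keep-≢ ψx≢a ψx≢j = keep (λ { refl → ψx≢a ψu≡a }) (ψx≢j ∘ proj₂)

      smaller : classSize ψ′ < classSize ψ
      smaller = classSize-< {ψ} {ψ′}
        (λ v → patch-elim (_≟ u) (λ _ _ → j) φ v (λ e → e ≡ a → ψ v ≡ a) (λ { refl _ → ψu≡a })
          (λ _ → patch-elim X? new ψ v (λ e → e ≡ a → ψ v ≡ a)
            (λ q eq → ⊥-elim (proj₁ (proj₂ (missing v q)) eq)) (λ _ → id)))
        u ψu≡a (λ eq → j≢a (trans (sym ψ′u≡j) eq))

      u-good : Good ψ′ u
      u-good with full j j≢a
      -- The dispensable neighbour is one that lost colour `j`; the neighbours of the other colours
      -- kept theirs.
      ... | x , u~x , ψx≡j = x , u~x , λ c c≢a c≢ψ′u → witness c c≢a (λ { refl → c≢ψ′u (sym ψ′u≡j) })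
        where
        witness : ∀ c → c ≢ a → c ≢ j → ∃[ z ] (u ~ z × z ≢ x × ψ′ z ≡ c)
        witness c c≢a c≢j with full c c≢a
        ... | z , u~z , refl = z , u~z , (λ { refl → c≢j ψx≡j }) , keep-≢ c≢a c≢j

      -- Besides `u`, only vertices of `X` changed colour, so a good vertex of colour `d` can be
      -- spoiled only through one of them other than `y`.
      hangs : ∀ {d} → d ≢ a → d ≢ j → ¬ (∃[ t ] (ψ′ t ≡ d × Good ψ′ t)) → Hangs ψ u j d
      hangs d≢a d≢j ¬rep t y refl t~y sp
        with any? (λ x → (u ~? x) ×-dec ((t ~? x) ×-dec ((ψ x ≟ j) ×-dec ¬? (x ≟ y))))
      ... | yes p = p
      ... | no ∄ = ⊥-elim (¬rep (t , same , y , t~y ,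
              spare-transfer same
                (λ t~x x≢y ψx≢a → keep (λ { refl → ψx≢a ψu≡a })
                  (λ Xx → ∄ (_ , proj₁ Xx , t~x , proj₂ Xx , x≢y)))
                sp))
        where
        same : ψ′ t ≡ ψ t
        same = keep-≢ d≢a d≢j

      result : Improvable ψ ⊎ ∃[ d ] (d ≢ a × d ≢ j × Hangs ψ u j d)
      result with any? (λ d → ¬? (d ≟ a) ×-dec ¬? (any? λ t → (ψ′ t ≟ d) ×-dec Good? ψ′ t))
      ... | yes (d , d≢a , ¬rep) = inj₂ (d , d≢a , d≢j , hangs d≢a d≢j ¬rep)
        where
        d≢j : d ≢ j
        d≢j refl = ¬rep (u , ψ′u≡j , u-good)
      ... | no ∄ = inj₁ (ψ′ , smaller , ψ′-proper , rep)
        where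
        rep : Represented ψ′
        rep c c≢a with any? (λ t → (ψ′ t ≟ c) ×-dec Good? ψ′ t)
        ... | yes p = p
        ... | no ¬p = ⊥-elim (∄ (c , c≢a , ¬p))

    -- All colours on good neighbours: a tree of radius 2

    -- β comes from a χ-colouring with χ < k; a is the spare colour for the clashes and d the one
    -- left out.
    iris⇒InBSpectrum : GirthAtLeast G 8 → ∀ {ψ : V → C} {u} → IsProper ψ → ψ u ≡ a →
      (∀ c → c ≢ a → GoodNeighbour ψ u c) → ∀ {d} → d ≢ a →
      ∀ {β : V → C} → IsProper β → (∀ v → β v ≢ a) → (∀ v → β v ≢ d) → InBSpectrum G k
    iris⇒InBSpectrum girth {ψ} {u} proper ψu≡a arms {d} d≢a {β} β-proper β≢a β≢d =
      avoiding⇒InBSpectrum φ d φ≢d φ-proper bvertex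
      where
      -- The ball of radius 2 pruned at colour `d`; asking `ψ p ≢ d` of the middle vertex keeps it
      -- connected to `u`.
      Tree : V → Set
      Tree v = ψ v ≢ d × (v ≡ u ⊎ (u ~ v ⊎ ∃[ p ] (u ~ p × p ~ v × ψ p ≢ d)))

      Tree? : Decidable Tree
      Tree? v = ¬? (ψ v ≟ d) ×-dec ((v ≟ u) ⊎-dec ((u ~? v) ⊎-dec
                any? λ p → (u ~? p) ×-dec ((p ~? v) ×-dec ¬? (ψ p ≟ d))))

      u∈Tree : Tree u
      u∈Tree = (λ eq → d≢a (trans (sym eq) ψu≡a)) , inj₁ refl

      outside-≢ : ∀ {w p} → ¬ Tree w → Tree p → w ≢ p
      outside-≢ w∉ p∈ refl = w∉ p∈

      tree-path : ∀ {v w} → Tree v → ¬ Tree w → w ~ v →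
        ∃[ xs ] (NonBacktracking (w ∷ v ∷ xs) × u ∈ v ∷ xs × length xs ≤ 2)
      tree-path (_ , inj₁ refl) w∉ w~v = [] , edge w~v , here refl , z≤n
      tree-path (_ , inj₂ (inj₁ u~v)) w∉ w~v =
        u ∷ [] , step w~v (outside-≢ w∉ u∈Tree) (edge (~-sym u~v)) , there (here refl) , s≤s z≤n
      tree-path {v} (_ , inj₂ (inj₂ (p , u~p , p~v , ψp≢d))) w∉ w~v with v ≟ u
      -- The last clause of `Tree` also admits `u`, by going out and back.
      ... | yes refl = [] , edge w~v , here refl , z≤n
      ... | no v≢u =
        p ∷ u ∷ [] ,
        step w~v (outside-≢ w∉ (ψp≢d , inj₂ (inj₁ u~p)))
          (step (~-sym p~v) v≢u (edge (~-sym u~p))) ,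
        there (there (here refl)) , s≤s (s≤s z≤n)

      -- Two attachments would close a cycle of length at most 6, each being joined to `u` by at
      -- most two edges of the tree.
      attachment-unique : ∀ {w p q} → ¬ Tree w → Tree p → Tree q → w ~ p → w ~ q → p ≡ q
      attachment-unique w∉ p∈ q∈ w~p w~q with tree-path p∈ w∉ w~p | tree-path q∈ w∉ w~q
      ... | _ , P , u∈P , lp | _ , Q , u∈Q , lq =
        step-towards-unique girth P Q u∈P u∈Q (≤-trans (+-mono-≤ lp lq) (n≤1+n 4))

      -- The edge `v w` and the two paths to `u`, of at most 3 edges each, would contain a cycle of
      -- length at most 7.
      attached-independent : ∀ {v w p q} → ¬ Tree v → ¬ Tree w → Tree p → Tree q →
        v ~ p → w ~ q → ¬ v ~ w
      attached-independent v∉ w∉ p∈ q∈ v~p w~q v~w with tree-path p∈ v∉ v~p | tree-path q∈ w∉ w~q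
      ... | _ , P , u∈P , lp | _ , Q , u∈Q , lq =
        outside-≢ v∉ q∈ (step-towards-unique girth
          (step (~-sym v~w) (outside-≢ w∉ p∈) P) Q (there u∈P) u∈Q (s≤s (+-mono-≤ lp lq)))

      Conflict : V → Set
      Conflict w = ∃[ p ] (w ~ p × Tree p × ψ p ≡ β w)

      Conflict? : Decidable Conflict
      Conflict? w = any? λ p → (w ~? p) ×-dec (Tree? p ×-dec (ψ p ≟ β w))

      outer φ : V → C
      outer = patch Conflict? (λ _ _ → a) β
      φ = patch Tree? (λ v _ → ψ v) outer

      φ≢d : ∀ v → φ v ≢ d
      φ≢d v = patch-elim Tree? (λ v _ → ψ v) outer v (_≢ d) proj₁
        (λ _ → patch-elim Conflict? (λ _ _ → a) β v (_≢ d) (λ _ → ≢-sym d≢a) (λ _ → β≢d v))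

      φ-tree : ∀ {v} → Tree v → φ v ≡ ψ v
      φ-tree {v} v∈ = patch-elim Tree? (λ v _ → ψ v) outer v (_≡ ψ v) (λ _ → refl) (λ v∉ → ⊥-elim (v∉ v∈))

      tree-outer : ∀ {v w} → Tree v → ¬ Tree w → v ~ w → ψ v ≢ outer w
      tree-outer {v} {w} v∈ w∉ v~w = patch-elim Conflict? (λ _ _ → a) β w (ψ v ≢_)
        -- A clashing `w` takes `a`; its only tree neighbour is the one that it clashes with, whose
        -- colour is a value of `β` and so not `a`.
        (λ { (p , w~p , p∈ , ψp≡βw) ψv≡a →
             β≢a w (trans (sym ψp≡βw) (trans (cong ψ (attachment-unique w∉ p∈ v∈ w~p (~-sym v~w))) ψv≡a)) })
        (λ ¬conflict ψv≡βw → ¬conflict (v , ~-sym v~w , v∈ , ψv≡βw))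

      outer-proper : ∀ {v w} → ¬ Tree v → ¬ Tree w → v ~ w → outer v ≢ outer w
      outer-proper {v} {w} v∉ w∉ v~w = patch-elim Conflict? (λ _ _ → a) β v (_≢ outer w)
        (λ { (p , v~p , p∈ , _) → patch-elim Conflict? (λ _ _ → a) β w (a ≢_)
             (λ { (q , w~q , q∈ , _) _ → attached-independent v∉ w∉ p∈ q∈ v~p w~q v~w })
             (λ _ → ≢-sym (β≢a w)) })
        (λ _ → patch-elim Conflict? (λ _ _ → a) β w (β v ≢_) (λ _ → β≢a v) (λ _ → β-proper v~w))

      φ-proper : IsProper φ
      φ-proper = patch-proper Tree? (λ v _ → ψ v) outer (λ _ _ → proper) tree-outer outer-proper

      bvertex : ∀ c → c ≢ d → ∃[ t ] (φ t ≡ c × (∀ c′ → c′ ≢ d → c′ ≢ c → Sees φ t c′))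
      bvertex c c≢d with c ≟ a
      ... | yes refl = u , trans (φ-tree u∈Tree) ψu≡a , sees
        where
        sees : ∀ c′ → c′ ≢ d → c′ ≢ a → Sees φ u c′
        sees c′ c′≢d c′≢a with arms c′ c′≢a
        ... | t , u~t , refl , _ = t , u~t , φ-tree (c′≢d , inj₂ (inj₁ u~t))
      ... | no c≢a with arms c c≢a
      ... | t , u~t , refl , y , t~y , sp = t , φ-tree (c≢d , inj₂ (inj₁ u~t)) , sees
        where
        sees : ∀ c′ → c′ ≢ d → c′ ≢ ψ t → Sees φ t c′
        sees c′ c′≢d c′≢ψt with c′ ≟ a
        ... | yes refl = u , ~-sym u~t , trans (φ-tree u∈Tree) ψu≡a
        ... | no c′≢a with sp c′ c′≢a c′≢ψt
        ... | x , t~x , _ , refl = x , t~x , φ-tree (c′≢d , inj₂ (inj₂ (t , u~t , t~x , c≢d)))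

    -- Colourings without improvement and their free colours

    -- What holds at a vertex of the class of `a` when neither way of recolouring it gives an
    -- improvement.
    StuckAt : (V → C) → V → Set
    StuckAt ψ v = ψ v ≡ a →
      (∀ c → c ≢ a → Sees ψ v c) ×
      (∀ j → j ≢ a → GoodNeighbour ψ v j ⊎ ∃[ d ] (d ≢ a × d ≢ j × Hangs ψ v j d))

    module _ (girth : GirthAtLeast G 8) {ψ : V → C} (proper : IsProper ψ)
             (rep : Represented ψ) (stuck : ∀ v → StuckAt ψ v) where

      private
        ≢-by-colour : ∀ {x y c c′} → ψ x ≡ c → ψ y ≡ c′ → c ≢ c′ → x ≢ y
        ≢-by-colour refl refl c≢c′ refl = c≢c′ refl

        class-≢-neighbour : ∀ {v w x} → ψ v ≡ a → ψ w ≡ a → w ~ x → v ≢ x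
        class-≢-neighbour ψv≡a ψw≡a w~x refl = proper w~x (trans ψw≡a (sym ψv≡a))

      Free : V → C → Set
      Free v e = e ≢ a × ¬ GoodNeighbour ψ v e

      -- The assignment j ↦ d, extended by the identity on the colours of good neighbours,
      -- is injective by the absence of 4-cycles, hence onto.
      abstract
        hanging-colour : ∀ v → ψ v ≡ a → Σ (C → C) λ f →
          ∀ e → Free v e → ∃[ j ] (f j ≡ e × Hangs ψ v j e)
        hanging-colour v ψv≡a = f , onto
          where
          image : ∀ j → ∃[ d ] ((¬ Free v j × d ≡ j) ⊎ (Free v j × Free v d × Hangs ψ v j d))
          image j with (¬? (j ≟ a)) ×-dec ¬? (GoodNeighbour? ψ v j)
          ... | no ¬free = j , inj₁ (¬free , refl)
          ... | yes free@(j≢a , ¬gn) with proj₂ (stuck v ψv≡a) j j≢a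
          ... | inj₁ gn = ⊥-elim (¬gn gn)
          ... | inj₂ (d , d≢a , d≢j , h) = d , inj₂ (free , (d≢a , ¬gn′) , h)
            where
            -- The image is free again: a good neighbour `t` of `v` coloured `d` would hang on a
            -- neighbour of `v`, closing a triangle.
            ¬gn′ : ¬ GoodNeighbour ψ v d
            ¬gn′ (t , v~t , ψt≡d , y , t~y , sp) with h t y ψt≡d t~y sp
            ... | x , v~x , t~x , _ = no-triangle girth v~x (~-sym t~x) (~-sym v~t)

          f : C → C
          f j = proj₁ (image j)

          f-injective : ∀ {i j} → f i ≡ f j → i ≡ j
          f-injective {i} {j} eq with image i | image j
          ... | d , inj₁ (_ , refl)     | _ , inj₁ (_ , refl)     = eq
          ... | d , inj₁ (¬fi , refl)   | _ , inj₂ (_ , fd , _)   = ⊥-elim (¬fi (subst (Free v) (sym eq) fd))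
          ... | d , inj₂ (_ , fd , _)   | _ , inj₁ (¬fj , refl)   = ⊥-elim (¬fj (subst (Free v) eq fd))
          f-injective {i} {j} refl | d , inj₂ (_ , (d≢a , _) , h) | _ , inj₂ (_ , _ , h′) with rep d d≢a
          -- A good vertex of the common image `d` hangs on neighbours of `v` of both colours, and
          -- these must coincide.
          ... | t , ψt≡d , y , t~y , sp with h t y ψt≡d t~y sp | h′ t y ψt≡d t~y sp
          ... | x , v~x , t~x , refl , _ | x′ , v~x′ , t~x′ , refl , _ =
            cong ψ (common-neighbour-unique girth
              (≢-by-colour ψv≡a ψt≡d (≢-sym d≢a)) v~x t~x v~x′ t~x′)

          onto : ∀ e → Free v e → ∃[ j ] (f j ≡ e × Hangs ψ v j e)
          onto e free with injective⇒surjective f f-injective e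
          ... | j , refl = j , refl , hangs (proj₂ (image j))
            where
            hangs : (¬ Free v j × f j ≡ j) ⊎ (Free v j × Free v (f j) × Hangs ψ v j (f j)) → Hangs ψ v j (f j)
            hangs (inj₁ (¬free , fj≡j)) = ⊥-elim (¬free (subst (Free v) fj≡j free))
            hangs (inj₂ (_ , _ , h))    = h

      -- A neighbour w of v in the class of a, together with a good vertex of the second free colour
      -- d′ supplied by `stuck`, would close a cycle of length 5, 6 or 7 through u.
      free-good-≁class : ∀ {u v w d} → ψ u ≡ a → Free u d → ψ v ≡ d → Good ψ v → ψ w ≡ a → ¬ w ~ v
      free-good-≁class {u} {v} {w} {d} ψu≡a free@(d≢a , ¬gn) ψv≡d good@(y , v~y , sp) ψw≡a w~v
        -- The free colour `d` is used twice: as an image it gives the common neighbour `x` of `u`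
        -- and `v`, as an argument it gives `d′`.
        with proj₂ (hanging-colour u ψu≡a) d free | proj₂ (stuck u ψu≡a) d d≢a
      ... | _ | inj₁ gn = ¬gn gn
      ... | j , _ , h | inj₂ (d′ , d′≢a , d′≢d , h′) with h v y ψv≡d v~y sp
      ... | x , u~x , v~x , _ = by-cases (GoodNeighbour? ψ w d′)
        where
        w≢u : w ≢ u
        w≢u refl = ¬gn (v , w~v , ψv≡d , good)
        start : ∀ {x′ l} → ψ x′ ≡ d → u ~ x′ →
          NonBacktracking (u ∷ x′ ∷ l) → NonBacktracking (w ∷ v ∷ x ∷ u ∷ x′ ∷ l)
        start ψx′≡d u~x′ p =
          step w~v (class-≢-neighbour ψw≡a ψu≡a u~x)
            (step v~x (≢-by-colour ψv≡d ψu≡a d≢a)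
              (step (~-sym u~x) (λ { refl → proper v~x (trans ψv≡d (sym ψx′≡d)) }) p))
        by-cases : Dec (GoodNeighbour ψ w d′) → ⊥
        by-cases (yes (t , w~t , ψt≡d′ , y′ , t~y′ , sp′)) with h′ t y′ ψt≡d′ t~y′ sp′
        ... | x′ , u~x′ , t~x′ , ψx′≡d , _ = no-short-return girth
          (start ψx′≡d u~x′ (step u~x′ (≢-by-colour ψu≡a ψt≡d′ (≢-sym d′≢a))
            (step (~-sym t~x′) (≢-sym (class-≢-neighbour ψw≡a ψu≡a u~x′)) (edge (~-sym w~t)))))
          (n≤1+n 6) (there (there (there (there (there (here refl))))))
        by-cases (no ¬gn′) with proj₂ (hanging-colour w ψw≡a) d′ (d′≢a , ¬gn′) | rep d′ d′≢a
        -- As `d′` is free at `w` too, `t` hangs on a neighbour `z` of `w` as well as on a neighbour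
        -- `x′` of `u`.
        ... | _ , _ , h″ | t , ψt≡d′ , y′ , t~y′ , sp′
          with h′ t y′ ψt≡d′ t~y′ sp′ | h″ t y′ ψt≡d′ t~y′ sp′
        ... | x′ , u~x′ , t~x′ , ψx′≡d , _ | z , w~z , t~z , _ with x′ ≟ z
        ... | yes refl = no-short-return girth
          (start ψx′≡d u~x′ (step u~x′ (≢-sym w≢u) (edge (~-sym w~z))))
          (m≤m+n 5 2) (there (there (there (there (here refl)))))
        -- The longest of the closed walks, `w v x u x′ t z w`, has 7 edges.
        ... | no x′≢z = no-short-return girth
          (start ψx′≡d u~x′ (step u~x′ (≢-by-colour ψu≡a ψt≡d′ (≢-sym d′≢a))
            (step (~-sym t~x′) x′≢z
              (step t~z (≢-by-colour ψt≡d′ ψw≡a d′≢a) (edge (~-sym w~z))))))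
          ≤-refl (there (there (there (there (there (there (here refl)))))))

      -- By the preceding lemma `e` is free at `w` too, so `w` and `t` have a common neighbour other
      -- than `y`, which closes a 4-cycle with `y`.
      free-spare-≁class : ∀ {u t y w e} → ψ u ≡ a → Free u e → ψ t ≡ e → t ~ y → Spare ψ t y →
        ψ w ≡ a → ¬ w ~ y
      free-spare-≁class {u} {t} {y} {w} {e} ψu≡a free@(e≢a , _) ψt≡e t~y sp ψw≡a w~y
        with GoodNeighbour? ψ w e
      ... | yes (t′ , w~t′ , ψt′≡e , good) = free-good-≁class ψu≡a free ψt′≡e good ψw≡a w~t′
      ... | no ¬gn with proj₂ (hanging-colour w ψw≡a) e (e≢a , ¬gn)
      ... | _ , _ , h with h t y ψt≡e t~y sp
      ... | x , w~x , t~x , _ , x≢y =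
        x≢y (common-neighbour-unique girth (≢-by-colour ψw≡a ψt≡e (≢-sym e≢a)) w~x t~x w~y t~y)

      -- Exchanging a for a free colour

      -- For each free `e` other than `d`, the neighbour `y e` of a good vertex `t e` takes `a`;
      -- then the class of `d` is dissolved. The b-vertices are `u` for `a`, good neighbours of `u`
      -- for their colours, and `t e` for the remaining free colours.
      free⇒InBSpectrum : ∀ {u d} → ψ u ≡ a → Free u d → InBSpectrum G k
      free⇒InBSpectrum {u} {d} ψu≡a free-d@(d≢a , _) = result
        where
        choice : ∀ e → ∃[ t ] ∃[ y ] (e ≢ a → ψ t ≡ e × t ~ y × Spare ψ t y)
        choice e with e ≟ a
        -- Default vertices for `a`, of which nothing is claimed.
        ... | yes e≡a = u , u , λ e≢a → ⊥-elim (e≢a e≡a)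
        ... | no e≢a with rep e e≢a
        ... | t , ψt≡e , y , t~y , sp = t , y , λ _ → ψt≡e , t~y , sp

        t y : C → V
        t e = proj₁ (choice e)
        y e = proj₁ (proj₂ (choice e))

        module _ {e} (free : Free u e) where
          ψt : ψ (t e) ≡ e
          ψt = proj₁ (proj₂ (proj₂ (choice e)) (proj₁ free))
          t~y : t e ~ y e
          t~y = proj₁ (proj₂ (proj₂ (proj₂ (choice e)) (proj₁ free)))
          spare : Spare ψ (t e) (y e)
          spare = proj₂ (proj₂ (proj₂ (proj₂ (choice e)) (proj₁ free)))
          good : Good ψ (t e)
          good = y e , t~y , spare
          t≢u : t e ≢ u
          t≢u = ≢-by-colour ψt ψu≡a (proj₁ free)
          u≁t : ¬ u ~ t e
          u≁t u~t = proj₂ free (t e , u~t , ψt , good)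
          y≁class : ∀ {w} → ψ w ≡ a → ¬ w ~ y e
          y≁class = free-spare-≁class ψu≡a free ψt t~y spare
          ψy≢a : ψ (y e) ≢ a
          ψy≢a ψy≡a = free-good-≁class ψu≡a free ψt good ψy≡a (~-sym t~y)
          -- The neighbour of `u` on which `t e` hangs; its colour is sent to `e`, so distinct free
          -- colours have distinct anchors.
          anchor : ∃[ x ] (u ~ x × t e ~ x × proj₁ (hanging-colour u ψu≡a) (ψ x) ≡ e × x ≢ y e)
          anchor with proj₂ (hanging-colour u ψu≡a) e free
          ... | j , fj≡e , h with h (t e) (y e) ψt t~y spare
          ... | x , u~x , t~x , refl , x≢y = x , u~x , t~x , fj≡e , x≢y

        -- The closed walk runs through both anchors: `u x (t e) (t f) x′ u`, with 5 edges.
        t≁t : ∀ {e f} → Free u e → Free u f → ¬ t e ~ t f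
        t≁t {e} {f} fe ff te~tf with anchor fe | anchor ff
        ... | x , u~x , t~x , _ | x′ , u~x′ , t~x′ , _ = no-short-return girth
          (step u~x (≢-sym (t≢u fe)) (step (~-sym t~x) (λ { refl → u≁t ff u~x })
            (step te~tf (λ { refl → u≁t fe u~x′ }) (step t~x′ (t≢u ff) (edge (~-sym u~x′))))))
          (m≤m+n 5 2) (there (there (there (there (here refl)))))

        t≢y : ∀ {e f} → Free u e → Free u f → t e ≢ y f
        t≢y {e} {f} fe ff te≡yf = t≁t ff fe (subst (t f ~_) (sym te≡yf) (t~y ff))

        -- The closed walk `u x (t e) (y e) (y f) (t f) x′ u` has 7 edges.
        y≁y : ∀ {e f} → Free u e → Free u f → ¬ y e ~ y f
        y≁y {e} {f} fe ff ye~yf with anchor fe | anchor ff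
        ... | x , u~x , t~x , _ , x≢y | x′ , u~x′ , t~x′ , _ , x′≢y = no-short-return girth
          (step u~x (≢-sym (t≢u fe)) (step (~-sym t~x) x≢y (step (t~y fe) (t≢y fe ff)
            (step ye~yf (≢-sym (t≢y ff fe)) (step (~-sym (t~y ff)) (≢-sym x′≢y)
              (step t~x′ (t≢u ff) (edge (~-sym u~x′))))))))
          ≤-refl (there (there (there (there (there (there (here refl)))))))

        t~y⇒≡ : ∀ {e f} → Free u e → Free u f → t e ~ y f → e ≡ f
        t~y⇒≡ {e} {f} fe ff te~yf with e ≟ f
        ... | yes e≡f = e≡f
        ... | no e≢f with anchor fe | anchor ff
        ... | x , u~x , t~x , fx≡e , _ | x′ , u~x′ , t~x′ , fx′≡f , x′≢y = ⊥-elim (no-short-return girth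
          (step t~x (t≢u fe) (step (~-sym u~x) (λ { refl → e≢f (trans (sym fx≡e) fx′≡f) })
            (step u~x′ (≢-sym (t≢u ff)) (step (~-sym t~x′) x′≢y
              (step (t~y ff) (≢-by-colour (ψt ff) (ψt fe) (≢-sym e≢f)) (edge (~-sym te~yf)))))))
          (n≤1+n 6) (there (there (there (there (there (here refl)))))))

        good-neighbour≁y : ∀ {b e} → u ~ b → Free u e → ¬ b ~ y e
        good-neighbour≁y {b} {e} u~b fe b~y with anchor fe
        ... | x , u~x , t~x , _ , x≢y = no-short-return girth
          (step u~b (≢-sym (≢-by-colour refl ψu≡a (ψy≢a fe))) (step b~y (λ { refl → u≁t fe u~b })
            (step (~-sym (t~y fe)) (≢-sym x≢y) (step t~x (t≢u fe) (edge (~-sym u~x))))))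
          (m≤m+n 5 2) (there (there (there (there (here refl)))))

        good-d≁y : ∀ {z e} → ψ z ≡ d → Good ψ z → e ≢ d → Free u e → ¬ z ~ y e
        good-d≁y {z} {e} ψz≡d (y′ , z~y′ , sp) e≢d fe z~y
          with proj₂ (hanging-colour u ψu≡a) d free-d | anchor fe
        ... | _ , _ , h | x , u~x , t~x , _ , x≢y with h z y′ ψz≡d z~y′ sp
        ... | x′ , u~x′ , z~x′ , _ = no-short-return girth
          (step u~x (≢-sym (t≢u fe)) (step (~-sym t~x) x≢y
            (step (t~y fe) (≢-by-colour (ψt fe) ψz≡d e≢d)
              (step (~-sym z~y) (λ { y≡x′ → y≁class fe ψu≡a (subst (u ~_) (sym y≡x′) u~x′) })
                (step z~x′ (≢-by-colour ψz≡d ψu≡a d≢a) (edge (~-sym u~x′)))))))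
          (n≤1+n 6) (there (there (there (there (there (here refl))))))

        Recoloured : V → Set
        Recoloured v = ∃[ e ] (e ≢ d × Free u e × v ≡ y e)

        Recoloured? : Decidable Recoloured
        Recoloured? v = any? λ e →
          ¬? (e ≟ d) ×-dec ((¬? (e ≟ a) ×-dec ¬? (GoodNeighbour? ψ u e)) ×-dec (v ≟ y e))

        ψ₁ : V → C
        ψ₁ = patch Recoloured? (λ _ _ → a) ψ

        ψ₁-proper : IsProper ψ₁
        ψ₁-proper = patch-proper Recoloured? (λ _ _ → a) ψ
          (λ { (_ , _ , fe , refl) (_ , _ , ff , refl) v~x _ → y≁y fe ff v~x })
          (λ { (_ , _ , fe , refl) _ v~x a≡ψx → y≁class fe (sym a≡ψx) (~-sym v~x) })
          (λ _ _ → proper)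

        ψ₁≢a⇒≡ : ∀ {v c} → c ≢ a → ψ₁ v ≡ c → ψ v ≡ c
        ψ₁≢a⇒≡ {v} {c} c≢a = patch-elim Recoloured? (λ _ _ → a) ψ v (λ e → e ≡ c → ψ v ≡ c)
          (λ _ a≡c → ⊥-elim (c≢a (sym a≡c))) (λ _ → id)

        -- If `z` saw all other colours, it would be good in `ψ`, with a neighbour `x` now coloured
        -- `a` as the dispensable one; but `x` can be neither in the old class of `a` nor a
        -- recoloured `y e`.
        missing : ∀ z → ψ₁ z ≡ d → ∃[ c ] (c ≢ d × ¬ Sees ψ₁ z c)
        missing z ψ₁z≡d = missing-colour ψ₁ d z λ all → sees-all (all a (≢-sym d≢a)) all
          where
          ψz≡d : ψ z ≡ d
          ψz≡d = ψ₁≢a⇒≡ d≢a ψ₁z≡d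
          sees-all : Sees ψ₁ z a → (∀ c → c ≢ d → Sees ψ₁ z c) → ⊥
          sees-all (x , z~x , ψ₁x≡a) all = patch-elim Recoloured? (λ _ _ → a) ψ x (λ e → e ≡ a → ⊥)
            (λ { (_ , e≢d , fe , refl) _ → good-d≁y ψz≡d good-z e≢d fe z~x })
            (λ _ ψx≡a → free-good-≁class ψu≡a free-d ψz≡d good-z ψx≡a (~-sym z~x))
            ψ₁x≡a
            where
            good-z : Good ψ z
            good-z = x , z~x , spare-z
              where
              spare-z : Spare ψ z x
              spare-z c c≢a c≢ψz with all c (λ c≡d → c≢ψz (trans c≡d (sym ψz≡d)))
              ... | x′ , z~x′ , ψ₁x′≡c =
                x′ , z~x′ , (λ { refl → c≢a (trans (sym ψ₁x′≡c) ψ₁x≡a) }) , ψ₁≢a⇒≡ c≢a ψ₁x′≡c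

        result : InBSpectrum G k
        result with eliminate-colour ψ₁ d ψ₁-proper missing
        ... | φ , φ-proper , φ≢d , φ-keep = avoiding⇒InBSpectrum φ d φ≢d φ-proper bvertex
          where
          keep : ∀ {v} → ¬ Recoloured v → ψ v ≢ d → φ v ≡ ψ v
          keep {v} ¬r ψv≢d = trans (φ-keep v (λ eq → ψv≢d (trans (sym same) eq))) same
            where
            same : ψ₁ v ≡ ψ v
            same = patch-no Recoloured? (λ _ _ → a) ψ v ¬r
          becomes-a : ∀ {v} → ψ₁ v ≡ a → φ v ≡ a
          becomes-a {v} eq = trans (φ-keep v (λ eq′ → d≢a (trans (sym eq′) eq))) eq
          φu≡a : φ u ≡ a
          φu≡a = becomes-a (patch-elim Recoloured? (λ _ _ → a) ψ u (_≡ a) (λ _ → refl) (λ _ → ψu≡a))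
          neighbour-not-recoloured : ∀ {x} → u ~ x → ¬ Recoloured x
          neighbour-not-recoloured u~x (_ , _ , fe , refl) = y≁class fe ψu≡a u~x

          bvertex : ∀ c → c ≢ d → ∃[ s ] (φ s ≡ c × (∀ c′ → c′ ≢ d → c′ ≢ c → Sees φ s c′))
          bvertex c c≢d with c ≟ a | GoodNeighbour? ψ u c
          ... | yes refl | _ = u , φu≡a , sees
            where
            sees : ∀ c′ → c′ ≢ d → c′ ≢ a → Sees φ u c′
            sees c′ c′≢d c′≢a with proj₁ (stuck u ψu≡a) c′ c′≢a
            ... | x , u~x , refl = x , u~x , keep (neighbour-not-recoloured u~x) c′≢d
          ... | no c≢a | yes (b , u~b , refl , _ , _ , sp) =
            b , keep (neighbour-not-recoloured u~b) c≢d , sees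
            where
            sees : ∀ c′ → c′ ≢ d → c′ ≢ ψ b → Sees φ b c′
            sees c′ c′≢d c′≢ψb with c′ ≟ a
            ... | yes refl = u , ~-sym u~b , φu≡a
            ... | no c′≢a with sp c′ c′≢a c′≢ψb
            ... | x , b~x , _ , refl =
              x , b~x , keep (λ { (_ , _ , fe , refl) → good-neighbour≁y u~b fe b~x }) c′≢d
          ... | no c≢a | no ¬gn =
            t c , trans (keep t-not-recoloured (λ eq → c≢d (trans (sym (ψt fc)) eq))) (ψt fc) , sees
            where
            fc : Free u c
            fc = c≢a , ¬gn
            t-not-recoloured : ¬ Recoloured (t c)
            t-not-recoloured (_ , _ , fe , eq) = t≢y fc fe eq
            sees : ∀ c′ → c′ ≢ d → c′ ≢ c → Sees φ (t c) c′
            sees c′ c′≢d c′≢c with c′ ≟ a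
            ... | yes refl = y c , t~y fc , becomes-a
              (patch-elim Recoloured? (λ _ _ → a) ψ (y c) (_≡ a) (λ _ → refl)
                (λ ¬r → ⊥-elim (¬r (c , c≢d , fc , refl))))
            ... | no c′≢a with spare fc c′ c′≢a (λ eq → c′≢c (trans eq (ψt fc)))
            ... | x , t~x , x≢y , refl = x , t~x , keep not-recoloured c′≢d
              where
              not-recoloured : ¬ Recoloured x
              -- The only recoloured vertex that `t c` can see is `y c`.
              not-recoloured (_ , _ , fe , refl) = x≢y (cong y (sym (t~y⇒≡ fc fe t~x)))

    -- Induction on the class of `a` and descent in the number of colours

    stuck-or-improvable : ∀ {ψ} → IsProper ψ → Represented ψ → Improvable ψ ⊎ (∀ v → StuckAt ψ v)
    stuck-or-improvable {ψ} proper rep = ∀-⊎ at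
      where
      per-colour : ∀ {v} → ψ v ≡ a → (∀ c → c ≢ a → Sees ψ v c) → ∀ j → Improvable ψ ⊎
        (j ≢ a → GoodNeighbour ψ v j ⊎ ∃[ d ] (d ≢ a × d ≢ j × Hangs ψ v j d))
      per-colour {v} ψv≡a full j with j ≟ a | GoodNeighbour? ψ v j
      ... | yes j≡a | _      = inj₂ λ j≢a → ⊥-elim (j≢a j≡a)
      ... | no _    | yes gn = inj₂ λ _ → inj₁ gn
      ... | no j≢a  | no ¬gn with empty-neighbour-class proper ψv≡a full j≢a ¬gn
      ... | inj₁ improvable = inj₁ improvable
      ... | inj₂ hangs      = inj₂ λ _ → inj₂ hangs

      at : ∀ v → Improvable ψ ⊎ StuckAt ψ v
      at v with ψ v ≟ a
      ... | no ψv≢a = inj₂ λ ψv≡a → ⊥-elim (ψv≢a ψv≡a)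
      ... | yes ψv≡a with sees-all-or-misses ψ a v
      ... | inj₂ (c , c≢a , ¬s) = inj₁ (recolour-into-missing proper rep ψv≡a c≢a ¬s)
      ... | inj₁ full with ∀-⊎ (per-colour ψv≡a full)
      ... | inj₁ improvable = inj₁ improvable
      ... | inj₂ colours    = inj₂ λ _ → full , colours

    -- Improves as long as possible. A stuck colouring either does not use `a`, or has a vertex `u`
    -- coloured `a` that has a free colour or is the centre of a tree.
    represented⇒InBSpectrum : GirthAtLeast G 8 →
      ∀ {d} → d ≢ a → ∀ {β : V → C} → IsProper β → (∀ v → β v ≢ a) → (∀ v → β v ≢ d) →
      ∀ ψ → Acc _<_ (classSize ψ) → IsProper ψ → Represented ψ → InBSpectrum G k
    represented⇒InBSpectrum girth d≢a β-proper β≢a β≢d ψ (acc smaller) proper rep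
      with stuck-or-improvable proper rep
    ... | inj₁ (ψ′ , lt , proper′ , rep′) =
      represented⇒InBSpectrum girth d≢a β-proper β≢a β≢d ψ′ (smaller lt) proper′ rep′
    ... | inj₂ stuck with any? (λ v → ψ v ≟ a)
    ... | no ∄ = avoiding⇒InBSpectrum ψ a (λ v eq → ∄ (v , eq)) proper bvertex
      where
      bvertex : ∀ c → c ≢ a → ∃[ t ] (ψ t ≡ c × (∀ c′ → c′ ≢ a → c′ ≢ c → Sees ψ t c′))
      bvertex c c≢a with rep c c≢a
      ... | t , refl , y , t~y , sp = t , refl , λ c′ c′≢a c′≢ψt →
        let x , t~x , _ , eq = sp c′ c′≢a c′≢ψt in x , t~x , eq
    ... | yes (u , ψu≡a) with any? (λ e → ¬? (e ≟ a) ×-dec ¬? (GoodNeighbour? ψ u e))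
    ... | yes (e , free) = free⇒InBSpectrum girth proper rep stuck ψu≡a free
    ... | no ∄ = iris⇒InBSpectrum girth proper ψu≡a arms d≢a β-proper β≢a β≢d
      where
      arms : ∀ c → c ≢ a → GoodNeighbour ψ u c
      arms c c≢a with GoodNeighbour? ψ u c
      ... | yes gn = gn
      ... | no ¬gn = ⊥-elim (∄ (c , c≢a , ¬gn))

  descend : GirthAtLeast G 8 → ∀ {c k} → ∃[ ψ ] IsColoring G c ψ → c < k →
    InBSpectrum G (suc k) → InBSpectrum G k
  descend girth {c} {suc k} (_ , col) (s≤s c≤k) b with IsColoring⇒Fin col | InBSpectrum⇒Fin b
  ... | β , β-proper , _ | ψ , ψ-proper , bv =
    -- Colour 0 is `a` and colour 1 is `d`; the colouring with `c` colours is shifted past both, for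
    -- which `c ≤ k` leaves room.
    represented⇒InBSpectrum zero girth {suc zero} (λ ())
      {λ v → suc (suc (inject≤ (β v) c≤k))}
      (λ u~v eq → β-proper u~v (inject≤-injective c≤k c≤k _ _ (suc-injective (suc-injective eq))))
      (λ _ ()) (λ _ ()) ψ (<-wellFounded _) ψ-proper represented
    where
    represented : Represented zero ψ
    represented e e≢0 with bv e
    ... | t , refl , sees with sees zero (≢-sym e≢0)
    ... | y , t~y , ψy≡0 = t , refl , y , t~y , λ c′ c′≢0 c′≢ψt →
      let x , t~x , ψx≡c′ = sees c′ c′≢ψt
      in  x , t~x , (λ { refl → c′≢0 (trans (sym ψx≡c′) ψy≡0) }) , ψx≡c′

  -- Removes one colour at a time from `b`; `descend` requires `c < k`, so `k = c` is settled by
  -- `chromatic∈spectrum`.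
  spectrum-below : GirthAtLeast G 8 → ∀ {c} → IsChromaticNumber G c →
    ∀ {k} → c ≤ k → ∀ {b} → InBSpectrum G b → k ≤ b → InBSpectrum G k
  spectrum-below girth χ c≤k {b} inb k≤b with m≤n⇒m<n∨m≡n k≤b
  ... | inj₂ refl = inb
  ... | inj₁ (s≤s k≤b′) with m≤n⇒m<n∨m≡n c≤k
  ... | inj₂ refl = chromatic∈spectrum χ
  ... | inj₁ c<k =
    spectrum-below girth χ c≤k (descend girth (proj₁ χ) (≤-trans c<k k≤b′) inb) k≤b′

theorem1 : (n : ℕ) (G : Graph n) → GirthAtLeast G 8 → BContinuous G
theorem1 n G girth c b χ@(_ , χ-min) (b∈S , b-max) k = mk⇔
  (λ k∈S → χ-min k (proj₁ k∈S , proj₁ (proj₂ k∈S)) , b-max k k∈S)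
  (λ { (c≤k , k≤b) → spectrum-below G girth χ c≤k b∈S k≤b })
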